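{- For every integer $n \ge 2$, $$\left\lfloor \frac{3n+4}{4}\right\rfloor \le \gamma_{MB}(P_3 \square P_n) \le \frac{4n+\sigma(n)}{3},$$ where $\sigma(n)=0$ if $3 \mid n$, $\sigma(n)=-1$ if $n\equiv 1 \pmod 3$, and $\sigma(n)=1$ if $n \equiv 2 \pmod 3$.
   Context: The Maker-Breaker domination game on a finite graph $G$ is played by Dominator and Staller, who alternately claim a previously unplayed vertex of $G$. Dominator wins as soon as his claimed vertices form a dominating set of $G$; Staller wins if she claims all vertices of some closed neighborhood $N_G[v]$. The D-game is the game where Dominator moves first. $\gamma_{MB}(G)$ is the minimum number of moves Dominator needs to win the D-game when both players play optimally (Dominator trying to win as fast as possible, Staller trying to delay this), and is $\infty$ if Dominator has no winning strategy. $P_k$ is the path on $k$ vertices and $\square$ denotes the Cartesian product of graphs. -}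

module Defs where

open import Data.Nat using (ℕ; zero; suc; _+_; _*_; _/_; _%_; _≤_)
open import Data.Integer as ℤ using (ℤ; +_; -[1+_])
open import Data.Fin using (Fin; toℕ)
open import Data.Product using (Σ; ∃; _×_; _,_)
open import Data.Sum using (_⊎_)
open import Data.List using (List; []; _∷_)
open import Data.List.Membership.Propositional using (_∈_; _∉_)
open import Data.Empty using (⊥)
open import Relation.Nullary using (¬_)
open import Relation.Binary.PropositionalEquality using (_≡_)

record Graph : Set₁ where
  field
    V   : Set
    Adj : V → V → Set

module _ (G : Graph) where
  open Graph G

  InN : V → V → Set
  InN u x = x ≡ u ⊎ Adj u x

  Dominating : List V → Set
  Dominating D = ∀ u → ∃ λ x → x ∈ D × InN u x

  StallerWon : List V → Set
  StallerWon S = ∃ λ u → ∀ x → InN u x → x ∈ S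

  Unplayed : List V → List V → V → Set
  Unplayed D S v = v ∉ D × v ∉ S

  -- DomWins k D S : in the position where Dominator has claimed D, Staller
  -- has claimed S, and it is Dominator's turn, Dominator has a strategy
  -- guaranteeing that his claimed vertices form a dominating set after at
  -- most k further moves of his, before Staller claims a closed neighbourhood.
  DomWins : ℕ → List V → List V → Set
  DomWins zero    D S = ⊥
  DomWins (suc k) D S =
    ∃ λ v → Unplayed D S v ×
      (Dominating (v ∷ D) ⊎
       (∀ w → Unplayed (v ∷ D) S w →
          ¬ StallerWon (w ∷ S) × DomWins k (v ∷ D) (w ∷ S)))

  -- γ_MB(G) = k : Dominator wins the D-game (from the empty board) in at
  -- most k moves, and in no fewer.  (γ_MB(G) = ∞ iff no such k exists.)
  IsGammaMB : ℕ → Set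
  IsGammaMB k = DomWins k [] [] × (∀ j → DomWins j [] [] → k ≤ j)

Path : ℕ → Graph
Path n = record { V = Fin n ; Adj = λ a b → suc (toℕ a) ≡ toℕ b ⊎ suc (toℕ b) ≡ toℕ a }

_□_ : Graph → Graph → Graph
G □ H = record
  { V   = Graph.V G × Graph.V H
  ; Adj = λ { (g , h) (g' , h') → (g ≡ g' × Graph.Adj H h h') ⊎ (Graph.Adj G g g' × h ≡ h') } }

σ : ℕ → ℤ
σ n with n % 3
... | 0 = + 0
... | 1 = -[1+ 0 ]
... | _ = + 1

{-# OPTIONS --safe #-}
-- Lower bound: when Dominator wins in k moves, some k vertices dominate the
-- grid.  Sweeping the columns of a dominating set from left to right, a
-- potential depending only on the sizes of the current column and of the part
-- of it dominated so far rises by at most 4 per chosen vertex and falls by at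
-- least 3 per column, whence 3n + 1 ≤ 4k.
--
-- Upper bound: cut the grid into 3 × 3 blocks, preceded by a column whose
-- centre Dominator takes at once (n ≡ 1) or by a 3 × 2 block (n ≡ 2), and let
-- Dominator answer Staller block by block.  He dominates a 3 × 2 block in 3
-- moves by pairing; in a 3 × 3 block he can answer any first move so that the
-- rest is dominated by a pairing with 3 pairs, which makes 4 moves.
module Submission where

open import Defs
open import Data.Nat using (ℕ; zero; suc; _≤_; _<_; z≤n; s≤s; s≤s⁻¹; _+_; _*_; _∸_; _/_)
import Data.Nat.Properties as ℕ
open import Data.Nat.DivMod using ([m+kn]%n≡m%n; m<n*o⇒m/o<n)
open import Data.Nat.Solver using (module +-*-Solver)
open import Data.Integer as ℤ using (+_)
import Data.Integer.Properties as ℤₚ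
open import Data.Fin using (Fin; toℕ; fromℕ<)
import Data.Fin.Properties as Fin
open import Data.Fin.Patterns using (0F; 1F; 2F)
open import Data.Fin.Subset using (Subset; ⊥; ⁅_⁆; _∪_; ∣_∣) renaming (_∈_ to _∈ˢ_)
open import Data.Fin.Subset.Properties using (anySubset?; x∈p∪q⁺; x∈⁅x⁆) renaming (_∈?_ to _∈ˢ?_)
open import Data.Vec using (_∷_; [])
open import Data.Bool using (_∨_)
open import Data.Product using (∃; _×_; _,_; proj₁; proj₂; uncurry)
import Data.Product as Product
open import Data.Product.Properties using (≡-dec)
open import Data.Sum using (_⊎_; inj₁; inj₂; [_,_]′)
import Data.Sum as Sum
open import Data.List using (List; []; _∷_; length)
open import Data.List.Membership.Propositional using (_∈_; _∉_)
import Data.List.Membership.DecPropositional as DecMembership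
open import Data.List.Relation.Unary.Any using (Any; here; there)
import Data.List.Relation.Unary.Any as Any
open import Data.List.Relation.Unary.Any.Properties using (¬Any[])
open import Data.List.Relation.Unary.All using (_∷_)
import Data.List.Relation.Unary.All as All
open import Data.List.Relation.Unary.AllPairs using (_∷_)
open import Data.List.Relation.Unary.Unique.Propositional using (Unique)
open import Data.List.Relation.Unary.Unique.DecPropositional using (unique?)
open import Data.Unit using (⊤; tt)
import Data.Empty as Empty
open import Function using (_∘_; id)
open import Relation.Nullary using (¬_; Dec; yes; no; contradiction)
open import Relation.Nullary.Decidable using (_×-dec_; _⊎-dec_; _→-dec_; ¬?; map′; decidable-stable; from-yes)
open import Relation.Unary using (Decidable; Universal; Empty)
open import Relation.Binary.Definitions using (DecidableEquality)
open import Relation.Binary.PropositionalEquality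

-- Exhaustive search and least witnesses.

Searchable : Set → Set₁
Searchable A = ∀ {P : A → Set} → Decidable P → Dec (∃ P)

all-searchable : ∀ {A : Set} {P : A → Set} → Searchable A → Decidable P → Dec (∀ x → P x)
all-searchable any? P? =
  map′ (λ ¬∃ x → decidable-stable (P? x) (¬∃ ∘ (x ,_))) (λ ∀P (x , ¬Px) → ¬Px (∀P x)) (¬? (any? (¬? ∘ P?)))

least : ∀ {P : ℕ → Set} → Decidable P → ∀ k → P k → ∃ λ m → P m × (∀ j → P j → m ≤ j)
least P? zero pk = 0 , pk , λ _ _ → z≤n
least P? (suc k) pk with P? 0
... | yes p0 = 0 , p0 , λ _ _ → z≤n
... | no ¬p0 with least (P? ∘ suc) k pk
...   | m , pm , minimal = suc m , pm , λ where
          zero    p0 → contradiction p0 ¬p0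
          (suc j) pj → s≤s (minimal j pj)

-- Deciding the game on a finite graph, and dominating sets from wins.

module FiniteGame (G : Graph) (_≟_ : DecidableEquality (Graph.V G))
  (any? : Searchable (Graph.V G)) (inN? : ∀ u x → Dec (InN G u x)) where

  open DecMembership _≟_ using (_∈?_; _∉?_)

  unplayed? : ∀ D S v → Dec (Unplayed G D S v)
  unplayed? D S v = (v ∉? D) ×-dec (v ∉? S)

  dominating? : ∀ D → Dec (Dominating G D)
  dominating? D = all-searchable any? λ u → any? λ x → (x ∈? D) ×-dec inN? u x

  stallerWon? : ∀ S → Dec (StallerWon G S)
  stallerWon? S = any? λ u → all-searchable any? λ x → inN? u x →-dec (x ∈? S)

  -- Decidability lets `least` turn a winning bound into an exact value constructively.
  domWins? : ∀ k D S → Dec (DomWins G k D S)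
  domWins? zero    D S = no λ ()
  domWins? (suc k) D S =
    any? λ v → unplayed? D S v ×-dec (dominating? (v ∷ D) ⊎-dec
      all-searchable any? λ w → unplayed? (v ∷ D) S w →-dec
        (¬? (stallerWon? (w ∷ S)) ×-dec domWins? k (v ∷ D) (w ∷ S)))

  -- If `u` were undominated, its whole closed neighbourhood would be played but outside `D`, hence
  -- inside `S`.
  full-board-dominating : ∀ D S → ¬ StallerWon G S → ¬ ∃ (Unplayed G D S) → Dominating G D
  full-board-dominating D S ¬won full u with any? (λ x → (x ∈? D) ×-dec inN? u x)
  ... | yes dominated = dominated
  ... | no undominated = contradiction (u , won) ¬won
    where
    won : ∀ x → InN G u x → x ∈ S
    won x ux = decidable-stable (x ∈? S) λ x∉S → full (x , (λ x∈D → undominated (x , x∈D , ux)) , x∉S)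

  domWins⇒dominating : ∀ k D S → ¬ StallerWon G S → DomWins G k D S →
    ∃ λ D′ → Dominating G D′ × length D′ ≤ k + length D
  domWins⇒dominating (suc k) D S ¬won (v , _ , inj₁ dom) = v ∷ D , dom , s≤s (ℕ.m≤n+m _ k)
  domWins⇒dominating (suc k) D S ¬won (v , _ , inj₂ next) with any? (unplayed? (v ∷ D) S)
  -- With no free vertex left `next` is vacuous, so domination has to come from the full board.
  ... | no full = v ∷ D , full-board-dominating (v ∷ D) S ¬won full , s≤s (ℕ.m≤n+m _ k)
  ... | yes (w , w-free) with next w w-free
  ...   | ¬won′ , wins with domWins⇒dominating k (v ∷ D) (w ∷ S) ¬won′ wins
  ...     | D′ , dom , len = D′ , dom , ℕ.≤-trans len (ℕ.≤-reflexive (ℕ.+-suc k _))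

-- Strategies confined to a region, their composition, and pairings.

module Strategy (G : Graph) (_≟_ : DecidableEquality (Graph.V G))
  (inN? : ∀ u x → Dec (InN G u x)) where

  open Graph G
  open DecMembership _≟_ using (_∈?_)

  -- Staller to move: using k cells of A, Dominator dominates every vertex
  -- outside K.  Staller's move w may be any vertex whatsoever; a w outside A
  -- amounts to her passing in A.
  Secures : ℕ → (V → Set) → (V → Set) → Set
  Secures zero    A K = Universal K
  Secures (suc k) A K = ∀ w → ∃ λ v → A v × v ≢ w ×
    Secures k (λ x → A x × x ≢ v × x ≢ w) (λ u → K u ⊎ InN G u v)

  secures-mono : ∀ k {A A′ K K′ : V → Set} → (∀ {x} → A x → A′ x) → (∀ {u} → K u → K′ u) →
    Secures k A K → Secures k A′ K′
  secures-mono zero    A⊆ K⊆ all = λ u → K⊆ (all u)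
  secures-mono (suc k) A⊆ K⊆ s w with s w
  ... | v , v∈A , v≢w , s′ =
    v , A⊆ v∈A , v≢w , secures-mono k (Product.map₁ A⊆) (Sum.map₁ K⊆) s′

  -- Dominator answers in `B` when Staller plays there and in `A` otherwise, until one budget is
  -- spent; then the other strategy answers everything. Disjointness keeps the idle region intact.
  compose : ∀ k l {A B K L : V → Set} → Decidable B → (∀ {x} → A x → ¬ B x) →
    Secures k A K → Secures l B L → Secures (k + l) (λ x → A x ⊎ B x) (λ u → K u × L u)
  compose zero l B? disj s t = secures-mono l inj₂ (λ {u} Lu → s u , Lu) t
  compose (suc k) zero B? disj s t rewrite ℕ.+-identityʳ k =
    secures-mono (suc k) inj₁ (λ {u} Ku → Ku , t u) s
  compose (suc k) (suc l) {A} {B} {K} {L} B? disj s t w with B? w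
  ... | yes w∈B with t w
  ...   | v , v∈B , v≢w , t′ rewrite ℕ.+-suc k l =
    v , inj₂ v∈B , v≢w ,
    secures-mono (suc (k + l))
      [ (λ x∈A → inj₁ x∈A , (λ { refl → disj x∈A v∈B }) , λ { refl → disj x∈A w∈B })
      , Product.map₁ inj₂ ]′
      (λ (Ku , Lu) → Sum.map₁ (Ku ,_) Lu)
      (compose (suc k) l (λ x → B? x ×-dec (¬? (x ≟ v) ×-dec ¬? (x ≟ w))) (λ x∈A → disj x∈A ∘ proj₁) s t′)
  compose (suc k) (suc l) B? disj s t w | no w∉B with s w
  ... | v , v∈A , v≢w , s′ =
    v , inj₁ v∈A , v≢w ,
    secures-mono (k + suc l)
      [ Product.map₁ inj₁
      , (λ x∈B → inj₂ x∈B , (λ { refl → disj v∈A x∈B }) , λ { refl → w∉B x∈B }) ]′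
      (λ (Ku , Lu) → Sum.map₁ (_, Lu) Ku)
      (compose k (suc l) B? (disj ∘ proj₁) s′ t)

  -- Run the strategy against a Staller who keeps choosing `u`: a reply that dominates `u` lies in
  -- `A`, hence outside `S`.
  escape : ∀ k {A K S} → (∀ {x} → A x → x ∉ S) → Secures k A K →
    ∀ u → K u ⊎ ∃ λ x → InN G u x × x ∉ S
  escape zero    A∉S all u = inj₁ (all u)
  escape (suc k) A∉S s   u with s u
  ... | v , v∈A , _ , s′ with escape k (A∉S ∘ proj₁) s′ u
  ...   | inj₁ (inj₁ Ku) = inj₁ Ku
  ...   | inj₁ (inj₂ uv) = inj₂ (v , uv , A∉S v∈A)
  ...   | inj₂ found     = inj₂ found

  -- Links a board to `Secures`, which never mentions the claimed lists. `disjoint` turns a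
  -- dominating cell into one that Staller lacks.
  record Position (D S : List V) (A K : V → Set) : Set where
    field
      free      : ∀ {x} → A x → Unplayed G D S x
      dominated : ∀ {u} → K u → ∃ λ x → x ∈ D × InN G u x
      disjoint  : ∀ {x} → x ∈ D → x ∉ S

  open Position

  staller-not-won : ∀ k {D S A K} → Position D S A K → Secures k A K → ¬ StallerWon G S
  staller-not-won k pos s (u , won) with escape k (proj₂ ∘ free pos) s u
  ... | inj₂ (x , ux , x∉S) = x∉S (won x ux)
  ... | inj₁ Ku with dominated pos Ku
  ...   | x , x∈D , ux = disjoint pos x∈D (won x ux)

  advance : ∀ {D S A K v w} → Position D S A K → A v → v ≢ w → Unplayed G D S w →
    Position (v ∷ D) (w ∷ S) (λ x → A x × x ≢ v × x ≢ w) (λ u → K u ⊎ InN G u v)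
  advance pos v∈A v≢w (w∉D , _) .free (x∈A , x≢v , x≢w) with free pos x∈A
  ... | x∉D , x∉S = (λ { (here eq) → x≢v eq ; (there p) → x∉D p })
                  , (λ { (here eq) → x≢w eq ; (there p) → x∉S p })
  advance pos v∈A v≢w (w∉D , _) .dominated (inj₁ Ku) with dominated pos Ku
  ... | x , x∈D , ux = x , there x∈D , ux
  advance pos v∈A v≢w (w∉D , _) .dominated (inj₂ uv) = _ , here refl , uv
  advance pos v∈A v≢w (w∉D , _) .disjoint (here refl) =
    λ { (here eq) → v≢w eq ; (there p) → proj₂ (free pos v∈A) p }
  advance pos v∈A v≢w (w∉D , _) .disjoint (there x∈D) =
    λ { (here refl) → w∉D x∈D ; (there p) → disjoint pos x∈D p }

  -- The position is the one just after the pending move `v`, hence the extra move in the count.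
  dominator-plays : ∀ k {D S A K v} → Unplayed G D S v → Position (v ∷ D) S A K →
    Secures k A K → DomWins G (suc k) D S
  dominator-plays zero    {v = v} v-free pos all = v , v-free , inj₁ (λ u → dominated pos (all u))
  dominator-plays (suc k) {D} {S} {A} {K} {v} v-free pos s = v , v-free , inj₂ next
    where
    next : ∀ w → Unplayed G (v ∷ D) S w →
      ¬ StallerWon G (w ∷ S) × DomWins G (suc k) (v ∷ D) (w ∷ S)
    next w w-free with s w
    ... | v′ , v′∈A , v′≢w , s′ =
      -- The position after the reply `v′` has the same Staller list `w ∷ S`, so it also excludes a
      -- Staller win just before that reply.
      staller-not-won k pos′ s′ ,
      dominator-plays k
        (proj₁ (free pos v′∈A) , λ { (here eq) → v′≢w eq ; (there p) → proj₂ (free pos v′∈A) p })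
        pos′ s′
      where pos′ = advance pos v′∈A v′≢w w-free

  wins-after : ∀ k v {A K} → (∀ {x} → A x → x ≢ v) → (∀ {u} → K u → InN G u v) →
    Secures k A K → DomWins G (suc k) [] []
  wins-after k v A≢v K⊆N = dominator-plays k ((λ ()) , λ ()) record
    { free      = λ x∈A → (λ { (here eq) → A≢v x∈A eq }) , λ ()
    ; dominated = λ Ku → v , here refl , K⊆N Ku
    ; disjoint  = λ _ ()
    }

  -- Moving first, Dominator answers an imaginary Staller move.
  wins-first : ∀ k {A K} → V → Empty K → Secures (suc k) A K → DomWins G (suc k) [] []
  wins-first k w ¬K s with s w
  ... | v , _ , _ , s′ =
    wins-after k v (proj₁ ∘ proj₂) [ (λ Ku → contradiction Ku (¬K _)) , id ]′ s′

  -- Whichever cell of such a pair Dominator obtains, it dominates `u`.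
  Covers : V → V × V → Set
  Covers u (a , b) = InN G u a × InN G u b

  covers? : ∀ u p → Dec (Covers u p)
  covers? u (a , b) = inN? u a ×-dec inN? u b

  cells : List (V × V) → List V
  cells []             = []
  cells ((a , b) ∷ ps) = a ∷ b ∷ cells ps

  pair : ∀ {a b} → a ≢ b → Secures 1 (λ x → x ≡ a ⊎ x ≡ b) (λ u → ¬ Covers u (a , b))
  pair {a} {b} a≢b w with w ≟ a
  ... | yes refl = b , inj₂ refl , a≢b ∘ sym , claims-b
    where
    claims-b : ∀ u → ¬ Covers u (a , b) ⊎ InN G u b
    claims-b u with inN? u b
    ... | yes ub = inj₂ ub
    ... | no ¬ub = inj₁ (¬ub ∘ proj₂)
  -- Here `w` is `b` or lies outside the pair; taking `a` serves both cases.
  ... | no w≢a = a , inj₁ refl , w≢a ∘ sym , claims-a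
    where
    claims-a : ∀ u → ¬ Covers u (a , b) ⊎ InN G u a
    claims-a u with inN? u a
    ... | yes ua = inj₂ ua
    ... | no ¬ua = inj₁ (¬ua ∘ proj₁)

  -- The pairs are disjoint, so their one-move strategies compose; a vertex stays exempt only if it
  -- is exempt for every pair.
  pairing : ∀ ps → Unique (cells ps) →
    Secures (length ps) (_∈ cells ps) (λ u → ¬ Any (Covers u) ps)
  pairing [] _ u ()
  pairing ((a , b) ∷ ps) ((a≢b ∷ a∉) ∷ b∉ ∷ unique) =
    secures-mono (suc (length ps))
      [ [ here , there ∘ here ]′ , there ∘ there ]′
      (λ { (¬ab , ¬ps) (here c) → ¬ab c ; (¬ab , ¬ps) (there c) → ¬ps c })
      (compose 1 (length ps) (_∈? cells ps)
        (λ { (inj₁ refl) p → All.lookup a∉ p refl ; (inj₂ refl) p → All.lookup b∉ p refl })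
        (pair a≢b) (pairing ps unique))

  answer-then-pair : ∀ k (answer : V → V × List (V × V)) →
    (∀ w → let v , ps = answer w in length ps ≡ k × Unique (w ∷ v ∷ cells ps) ×
      (∀ u → InN G u v ⊎ Any (Covers u) ps)) →
    Secures (suc k) (λ _ → ⊤) (λ _ → Empty.⊥)
  answer-then-pair k answer ok w with answer w | ok w
  ... | v , ps | refl , (w≢v ∷ w∉) ∷ v∉ ∷ unique , cover =
    v , tt , w≢v ∘ sym ,
    secures-mono k
      (λ x∈ → tt , (λ { refl → All.lookup v∉ x∈ refl }) , λ { refl → All.lookup w∉ x∈ refl })
      (λ {u} ¬ps → [ inj₂ , (λ c → contradiction c ¬ps) ]′ (cover u))
      (pairing ps unique)

-- Transporting strategies along an injective map that preserves neighbourhoods.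

module Embedding (G H : Graph)
  (_≟G_ : DecidableEquality (Graph.V G)) (inNG? : ∀ u x → Dec (InN G u x))
  (_≟H_ : DecidableEquality (Graph.V H)) (inNH? : ∀ u x → Dec (InN H u x))
  (f : Graph.V G → Graph.V H)
  (f-injective : ∀ {x y} → f x ≡ f y → x ≡ y)
  (f-inN : ∀ {u x} → InN G u x → InN H (f u) (f x))
  (preimage? : ∀ y → Dec (∃ λ x → f x ≡ y))
  (origin : Graph.V G) where

  private
    module SG = Strategy G _≟G_ inNG?
    module SH = Strategy H _≟H_ inNH?

  -- `Coimage` holds vacuously off the image, so a transported strategy owes nothing to vertices
  -- there.
  Image Coimage : (Graph.V G → Set) → Graph.V H → Set
  Image   A y = ∃ λ x → f x ≡ y × A x
  Coimage K y = ∀ x → f x ≡ y → K x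

  -- The universal quantifier splits over the disjunction because injectivity leaves at most one
  -- preimage.
  coimage-⊎ : ∀ {K v y} → Coimage (λ u → K u ⊎ InN G u v) y → Coimage K y ⊎ InN H y (f v)
  coimage-⊎ {K} {y = y} c with preimage? y
  ... | no ¬pre = inj₁ λ x eq → contradiction (x , eq) ¬pre
  ... | yes (x , refl) with c x refl
  ...   | inj₁ Kx = inj₁ λ x′ eq → subst K (sym (f-injective eq)) Kx
  ...   | inj₂ xv = inj₂ (f-inN xv)

  transport : ∀ k {A K} → SG.Secures k A K → SH.Secures k (Image A) (Coimage K)
  transport zero s y x refl = s x
  transport (suc k) {A} {K} s w with preimage? w
  ... | yes (w₁ , refl) with s w₁
  ...   | v , v∈A , v≢w , s′ =
    f v , (v , refl , v∈A) , v≢w ∘ f-injective ,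
    SH.secures-mono k
      (λ { (x , refl , x∈A , x≢v , x≢w) → (x , refl , x∈A) , x≢v ∘ f-injective , x≢w ∘ f-injective })
      coimage-⊎ (transport k s′)
  -- A move off the image is a pass inside it; `origin` serves as Staller's imaginary move.
  transport (suc k) {A} {K} s w | no w∉ with s origin
  ...   | v , v∈A , _ , s′ =
    f v , (v , refl , v∈A) , (λ eq → w∉ (v , eq)) ,
    SH.secures-mono k
      (λ { (x , refl , x∈A , x≢v , _) → (x , refl , x∈A) , x≢v ∘ f-injective , λ eq → w∉ (x , eq) })
      coimage-⊎ (transport k s′)

-- The grid and its two kinds of block.

Grid : ℕ → Graph
Grid n = Path 3 □ Path n

Cell : ℕ → Set
Cell n = Fin 3 × Fin n

_≟_ : ∀ {n} → DecidableEquality (Cell n)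
_≟_ = ≡-dec Fin._≟_ Fin._≟_

any-cell? : ∀ {n} → Searchable (Cell n)
any-cell? P? =
  map′ (λ (i , j , p) → (i , j) , p) (λ ((i , j) , p) → i , j , p) (Fin.any? λ i → Fin.any? λ j → P? (i , j))

adj? : ∀ {n} (i j : Fin n) → Dec (Graph.Adj (Path n) i j)
adj? i j = (suc (toℕ i) ℕ.≟ toℕ j) ⊎-dec (suc (toℕ j) ℕ.≟ toℕ i)

inN? : ∀ {n} (u x : Cell n) → Dec (InN (Grid n) u x)
inN? u@(g , h) x@(g′ , h′) =
  (x ≟ u) ⊎-dec (((g Fin.≟ g′) ×-dec adj? h h′) ⊎-dec (adj? g g′ ×-dec (h Fin.≟ h′)))

module GridStrategy (n : ℕ) = Strategy (Grid n) _≟_ inN?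

-- For each first move of Staller, a reply and three pairs using six of the seven cells then left.
-- That every vertex is dominated by the reply or covered by a pair is a finite check.
answer₃ : Cell 3 → Cell 3 × List (Cell 3 × Cell 3)
answer₃ (0F , 0F) = (0F , 1F) , ((0F , 2F) , (1F , 1F)) ∷ ((1F , 0F) , (2F , 0F)) ∷ ((2F , 1F) , (2F , 2F)) ∷ []
answer₃ (0F , 1F) = (1F , 0F) , ((0F , 0F) , (1F , 1F)) ∷ ((0F , 2F) , (1F , 2F)) ∷ ((2F , 1F) , (2F , 2F)) ∷ []
answer₃ (0F , 2F) = (0F , 1F) , ((0F , 0F) , (1F , 0F)) ∷ ((1F , 2F) , (2F , 2F)) ∷ ((2F , 0F) , (2F , 1F)) ∷ []
answer₃ (1F , 0F) = (0F , 1F) , ((0F , 0F) , (1F , 1F)) ∷ ((1F , 2F) , (2F , 2F)) ∷ ((2F , 0F) , (2F , 1F)) ∷ []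
answer₃ (1F , 1F) = (0F , 1F) , ((0F , 0F) , (1F , 0F)) ∷ ((1F , 2F) , (2F , 2F)) ∷ ((2F , 0F) , (2F , 1F)) ∷ []
answer₃ (1F , 2F) = (0F , 1F) , ((0F , 2F) , (1F , 1F)) ∷ ((1F , 0F) , (2F , 0F)) ∷ ((2F , 1F) , (2F , 2F)) ∷ []
answer₃ (2F , 0F) = (1F , 0F) , ((0F , 0F) , (0F , 1F)) ∷ ((0F , 2F) , (1F , 2F)) ∷ ((2F , 1F) , (2F , 2F)) ∷ []
answer₃ (2F , 1F) = (1F , 0F) , ((0F , 1F) , (0F , 2F)) ∷ ((1F , 1F) , (2F , 0F)) ∷ ((1F , 2F) , (2F , 2F)) ∷ []
answer₃ (2F , 2F) = (1F , 2F) , ((0F , 0F) , (0F , 1F)) ∷ ((1F , 0F) , (1F , 1F)) ∷ ((2F , 0F) , (2F , 1F)) ∷ []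

secures-3×3 : GridStrategy.Secures 3 4 (λ _ → ⊤) (λ _ → Empty.⊥)
secures-3×3 = answer-then-pair 3 answer₃ (from-yes (all-searchable any-cell? λ w →
  let v , ps = answer₃ w in
  (length ps ℕ.≟ 3) ×-dec (unique? _≟_ (w ∷ v ∷ cells ps) ×-dec
    all-searchable any-cell? λ u → inN? u v ⊎-dec Any.any? (covers? u) ps)))
  where open GridStrategy 3

-- Each pair is a row, which lies in the closed neighbourhood of both its cells.
pairs₂ : List (Cell 2 × Cell 2)
pairs₂ = ((0F , 0F) , (0F , 1F)) ∷ ((1F , 0F) , (1F , 1F)) ∷ ((2F , 0F) , (2F , 1F)) ∷ []

secures-3×2 : GridStrategy.Secures 2 3 (λ _ → ⊤) (λ _ → Empty.⊥)
secures-3×2 = secures-mono 3 (λ _ → tt) (λ {u} ¬any → ¬any (covered u))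
  (pairing pairs₂ (from-yes (unique? _≟_ (cells pairs₂))))
  where
  open GridStrategy 2
  covered : ∀ u → Any (Covers u) pairs₂
  covered = from-yes (all-searchable any-cell? λ u → Any.any? (covers? u) pairs₂)

-- Placing blocks side by side in a long grid.

module Blocks (n : ℕ) where
  open GridStrategy n

  Between : ℕ → ℕ → Cell n → Set
  Between r b (_ , j) = r ≤ toℕ j × toℕ j < r + b

  between? : ∀ r b → Decidable (Between r b)
  between? r b (_ , j) = (r ℕ.≤? toℕ j) ×-dec (toℕ j ℕ.<? r + b)

  SecuresColumns : ℕ → ℕ → ℕ → Set
  SecuresColumns k r b = Secures k (Between r b) (λ y → ¬ Between r b y)

  module Shift {b} (r : ℕ) (r+b≤n : r + b ≤ n) where

    shift< : (c : Fin b) → r + toℕ c < n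
    shift< c = ℕ.<-≤-trans (ℕ.+-monoʳ-< r (Fin.toℕ<n c)) r+b≤n

    shift : Cell b → Cell n
    shift (i , c) = i , fromℕ< (shift< c)

    toℕ-shift : ∀ x → toℕ (proj₂ (shift x)) ≡ r + toℕ (proj₂ x)
    toℕ-shift (i , c) = Fin.toℕ-fromℕ< (shift< c)

    shift-injective : ∀ {x y} → shift x ≡ shift y → x ≡ y
    shift-injective {x} {y} eq = cong₂ _,_ (cong proj₁ eq)
      (Fin.toℕ-injective (ℕ.+-cancelˡ-≡ r _ _
        (trans (sym (toℕ-shift x)) (trans (cong (toℕ ∘ proj₂) eq) (toℕ-shift y)))))

    shift-step : ∀ x y → suc (toℕ (proj₂ x)) ≡ toℕ (proj₂ y) →
      suc (toℕ (proj₂ (shift x))) ≡ toℕ (proj₂ (shift y))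
    shift-step x y eq rewrite toℕ-shift x | toℕ-shift y = trans (sym (ℕ.+-suc r _)) (cong (λ k → r + k) eq)

    shift-inN : ∀ {u x} → InN (Grid b) u x → InN (Grid n) (shift u) (shift x)
    shift-inN (inj₁ refl) = inj₁ refl
    shift-inN {u} {x} (inj₂ (inj₁ (i≡ , adj))) =
      inj₂ (inj₁ (i≡ , Sum.map (shift-step u x) (shift-step x u) adj))
    shift-inN (inj₂ (inj₂ (adj , refl))) = inj₂ (inj₂ (adj , refl))

    shift-between : ∀ x → Between r b (shift x)
    shift-between x rewrite toℕ-shift x = ℕ.m≤m+n r _ , ℕ.+-monoʳ-< r (Fin.toℕ<n (proj₂ x))

    unshift : ∀ {y} → Between r b y → ∃ λ x → shift x ≡ y
    unshift {i , j} (r≤j , j<r+b) = (i , fromℕ< j∸r<b) , cong (i ,_) (Fin.toℕ-injective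
      (trans (toℕ-shift (i , fromℕ< j∸r<b))
        (trans (cong (λ k → r + k) (Fin.toℕ-fromℕ< j∸r<b)) (ℕ.m+[n∸m]≡n r≤j))))
      where
      j∸r<b : toℕ j ∸ r < b
      j∸r<b = ℕ.+-cancelˡ-< r _ _ (subst (_< r + b) (sym (ℕ.m+[n∸m]≡n r≤j)) j<r+b)

    -- Every cell of these columns has a preimage under `shift`, so the `Coimage` of the empty set
    -- lies outside them.
    place : ∀ k → Cell b → GridStrategy.Secures b k (λ _ → ⊤) (λ _ → Empty.⊥) → SecuresColumns k r b
    place k origin s = secures-mono k
      (λ { (x , refl , _) → shift-between x })
      (λ c y∈ → uncurry c (unshift y∈))
      (transport k s)
      where
      open Embedding (Grid b) (Grid n) _≟_ inN? _≟_ inN? shift shift-injective shift-inN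
        (λ y → any-cell? λ x → shift x ≟ y) origin

  open Shift using (place)

  merge : ∀ k l r a b → SecuresColumns k r a → SecuresColumns l (r + a) b → SecuresColumns (k + l) r (a + b)
  merge k l r a b s t = secures-mono (k + l)
    [ (λ (r≤ , <r+a) → r≤ , ℕ.<-≤-trans <r+a (ℕ.+-monoʳ-≤ r (ℕ.m≤m+n a b)))
    , (λ (r+a≤ , <r+a+b) → ℕ.≤-trans (ℕ.m≤m+n r a) r+a≤ , ℕ.<-≤-trans <r+a+b (ℕ.≤-reflexive (ℕ.+-assoc r a b))) ]′
    (λ {u} → outside-both u)
    (compose k l (between? (r + a) b) (λ (_ , <r+a) (r+a≤ , _) → ℕ.<⇒≱ <r+a r+a≤) s t)
    where
    outside-both : ∀ u → ¬ Between r a u × ¬ Between (r + a) b u → ¬ Between r (a + b) u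
    outside-both (_ , j) (¬left , ¬right) (r≤ , <r+ab) with toℕ j ℕ.<? r + a
    ... | yes <r+a = ¬left (r≤ , <r+a)
    ... | no ≮r+a = ¬right (ℕ.≮⇒≥ ≮r+a , ℕ.<-≤-trans <r+ab (ℕ.≤-reflexive (sym (ℕ.+-assoc r a b))))

  blocks : ∀ m r → r + m * 3 ≤ n → SecuresColumns (m * 4) r (m * 3)
  blocks zero r _ u (r≤ , <r) = ℕ.<⇒≱ <r (subst (_≤ _) (sym (ℕ.+-identityʳ r)) r≤)
  blocks (suc m) r le = merge 4 (m * 4) r 3 (m * 3)
    (place r (ℕ.≤-trans (ℕ.+-monoʳ-≤ r (ℕ.m≤m+n 3 (m * 3))) le) 4 (0F , 0F) secures-3×3)
    (blocks m (r + 3) (subst (_≤ n) (sym (ℕ.+-assoc r 3 (m * 3))) le))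

-- Winning strategies for the three residues of the width.

open GridStrategy using (wins-first; wins-after)
open Blocks using (blocks; merge; module Shift)

everywhere : ∀ {n} (u : Cell n) → ¬ ¬ Blocks.Between n 0 n u
everywhere (_ , j) ¬b = ¬b (z≤n , Fin.toℕ<n j)

domWins-3m : ∀ m → DomWins (Grid (suc m * 3)) (suc m * 4) [] []
domWins-3m m =
  wins-first _ _ (0F , 0F) everywhere (blocks n (suc m) 0 ℕ.≤-refl)
  where n = suc m * 3

domWins-3m+1 : ∀ m → DomWins (Grid (1 + m * 3)) (1 + m * 4) [] []
domWins-3m+1 m =
  -- The centre of column 0 dominates that column; the blocks start at column 1 and so avoid it.
  wins-after _ (m * 4) (1F , 0F) (λ { (() , _) refl }) first-column (blocks (1 + m * 3) m 1 ℕ.≤-refl)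
  where
  first-column : ∀ {u} → ¬ Blocks.Between (1 + m * 3) 1 (m * 3) u → InN (Grid (1 + m * 3)) u (1F , 0F)
  first-column {0F , 0F} _ = inj₂ (inj₂ (inj₁ refl , refl))
  first-column {1F , 0F} _ = inj₁ refl
  first-column {2F , 0F} _ = inj₂ (inj₂ (inj₂ refl , refl))
  first-column {_ , Fin.suc j} ¬b = contradiction (s≤s z≤n , s≤s (Fin.toℕ<n j)) ¬b

domWins-3m+2 : ∀ m → DomWins (Grid (2 + m * 3)) (3 + m * 4) [] []
domWins-3m+2 m =
  wins-first n _ (0F , 0F) everywhere
    (merge n 3 (m * 4) 0 2 (m * 3)
      (Shift.place n 0 (s≤s (s≤s z≤n)) 3 (0F , 0F) secures-3×2)
      (blocks n m 2 ℕ.≤-refl))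
  where n = 2 + m * 3

-- Counting a list of cells column by column.

-- Numbered from 1, so that columns 0 and n + 1 are empty borders.
column : ∀ {n} → ℕ → List (Cell n) → Subset 3
column m [] = ⊥
column m ((i , h) ∷ D) with suc (toℕ h) ℕ.≟ m
... | yes _ = ⁅ i ⁆ ∪ column m D
... | no  _ = column m D

columns-size : ∀ {n} → ℕ → List (Cell n) → ℕ
columns-size zero    D = 0
columns-size (suc m) D = columns-size m D + ∣ column (suc m) D ∣

∈-column : ∀ {n} {D : List (Cell n)} {i h} m → suc (toℕ h) ≡ m → (i , h) ∈ D → i ∈ˢ column m D
∈-column {h = h} m eq (here refl) with suc (toℕ h) ℕ.≟ m
... | yes _ = x∈p∪q⁺ (inj₁ (x∈⁅x⁆ _))
... | no ≢m = contradiction eq ≢m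
∈-column {D = (i′ , h′) ∷ D} m eq (there x∈D) with suc (toℕ h′) ℕ.≟ m
... | yes _ = x∈p∪q⁺ (inj₂ (∈-column m eq x∈D))
... | no  _ = ∈-column m eq x∈D

column-beyond : ∀ {n} (D : List (Cell n)) → column (suc n) D ≡ ⊥
column-beyond [] = refl
column-beyond {n} ((i , h) ∷ D) with suc (toℕ h) ℕ.≟ suc n
... | yes eq = contradiction (ℕ.suc-injective eq) (ℕ.<⇒≢ (Fin.toℕ<n h))
... | no  _  = column-beyond D

all-subset? : ∀ {k} {P : Subset k → Set} → Decidable P → Dec (∀ p → P p)
all-subset? = all-searchable anySubset?

∣⁅i⁆∪p∣≤1+∣p∣ : ∀ (i : Fin 3) p → ∣ ⁅ i ⁆ ∪ p ∣ ≤ suc ∣ p ∣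
∣⁅i⁆∪p∣≤1+∣p∣ = from-yes (Fin.all? λ i → all-subset? {3} λ p → ∣ ⁅ i ⁆ ∪ p ∣ ℕ.≤? suc ∣ p ∣)

columns-size-∷-below : ∀ {n} m x (D : List (Cell n)) → m ≤ toℕ (proj₂ x) →
  columns-size m (x ∷ D) ≡ columns-size m D
columns-size-∷-below zero    x D _ = refl
columns-size-∷-below (suc m) (i , h) D m<h with suc (toℕ h) ℕ.≟ suc m
... | yes eq = contradiction (sym (ℕ.suc-injective eq)) (ℕ.<⇒≢ m<h)
... | no  _  = cong (λ k → k + ∣ column (suc m) D ∣) (columns-size-∷-below m (i , h) D (ℕ.<⇒≤ m<h))

-- A cell lies in a single column, so the counts of the earlier columns do not change. It may be
-- present already, whence an inequality.
columns-size-∷ : ∀ {n} m x (D : List (Cell n)) → columns-size m (x ∷ D) ≤ suc (columns-size m D)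
columns-size-∷ zero    x D = z≤n
columns-size-∷ (suc m) (i , h) D with suc (toℕ h) ℕ.≟ suc m
... | no  _ = ℕ.+-monoˡ-≤ _ (columns-size-∷ m (i , h) D)
... | yes eq = begin
  columns-size m ((i , h) ∷ D) + ∣ ⁅ i ⁆ ∪ c ∣
    ≡⟨ cong (λ k → k + ∣ ⁅ i ⁆ ∪ c ∣) (columns-size-∷-below m (i , h) D (ℕ.≤-reflexive (sym (ℕ.suc-injective eq)))) ⟩
  columns-size m D + ∣ ⁅ i ⁆ ∪ c ∣  ≤⟨ ℕ.+-monoʳ-≤ _ (∣⁅i⁆∪p∣≤1+∣p∣ i c) ⟩
  columns-size m D + suc ∣ c ∣      ≡⟨ ℕ.+-suc _ _ ⟩
  suc (columns-size m D + ∣ c ∣)    ∎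
  where
  open ℕ.≤-Reasoning
  c = column (suc m) D

columns-size≤length : ∀ {n} m (D : List (Cell n)) → columns-size m D ≤ length D
columns-size≤length zero    []      = z≤n
columns-size≤length {n} (suc m) [] = ℕ.≤-trans (ℕ.≤-reflexive (ℕ.+-identityʳ _)) (columns-size≤length {n} m [])
columns-size≤length m (x ∷ D) = ℕ.≤-trans (columns-size-∷ m x D) (s≤s (columns-size≤length m D))

-- Domination column by column, and the potential.

close : Subset 3 → Subset 3
close (a ∷ b ∷ c ∷ []) = (a ∨ b) ∷ (a ∨ b ∨ c) ∷ (b ∨ c) ∷ []

∈-close : ∀ p i → i ∈ˢ p → i ∈ˢ close p
∈-close = from-yes (all-subset? λ p → Fin.all? λ i → (i ∈ˢ? p) →-dec (i ∈ˢ? close p))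

adj-∈-close : ∀ p i j → Graph.Adj (Path 3) i j → j ∈ˢ p → i ∈ˢ close p
adj-∈-close = from-yes (all-subset? λ p → Fin.all? λ i → Fin.all? λ j →
  adj? i j →-dec ((j ∈ˢ? p) →-dec (i ∈ˢ? close p)))

-- Domination of the middle one of three consecutive columns: `close c` accounts for the column
-- itself, `p` and `x` for horizontal neighbours.
Covered : Subset 3 → Subset 3 → Subset 3 → Set
Covered p c x = ∀ i → i ∈ˢ (p ∪ close c) ∪ x

covered? : ∀ p c x → Dec (Covered p c x)
covered? p c x = Fin.all? λ i → i ∈ˢ? ((p ∪ close c) ∪ x)

-- The arguments are the size of the last column and the number of its cells
-- dominated so far.  The values are the shortest distances, in the graph of
-- these pairs, from the first columns, where a step that adds a column x costs
-- 4 ∣ x ∣ − 3 and the first column x costs 4 ∣ x ∣.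
weight : ℕ → ℕ → ℕ
weight 0 0 = 0
weight 0 1 = 1
weight 0 2 = 3
weight 0 _ = 6
weight 1 _ = 4
weight 2 _ = 6
weight _ _ = 9

-- `p ∪ close c` is the part of the current column dominated before the next column is known.
potential : Subset 3 → Subset 3 → ℕ
potential p c = weight ∣ c ∣ ∣ p ∪ close c ∣

potential-start : ∀ c → potential ⊥ c ≤ 4 * ∣ c ∣
potential-start = from-yes (all-subset? λ c → potential ⊥ c ℕ.≤? 4 * ∣ c ∣)

-- This is the triangle inequality for the distances in `weight`, confirmed over all triples of
-- subsets.
potential-step : ∀ p c x → Covered p c x → potential c x + 3 ≤ potential p c + 4 * ∣ x ∣
potential-step = from-yes (all-subset? λ p → all-subset? λ c → all-subset? λ x →
  covered? p c x →-dec (potential c x + 3 ℕ.≤? potential p c + 4 * ∣ x ∣))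

-- With an empty border on the right, the last column is fully dominated already; the least weight
-- of such a column is 4, for a single chosen cell.
potential-end : ∀ p c → Covered p c ⊥ → 4 ≤ potential p c
potential-end = from-yes (all-subset? λ p → all-subset? λ c →
  covered? p c ⊥ →-dec (4 ℕ.≤? potential p c))

-- The grid column with index `m` bears the number `suc m`, so its neighbours are numbered `m` and
-- `suc (suc m)`.
column-covered : ∀ {n} {D : List (Cell n)} → Dominating (Grid n) D → ∀ m → m < n →
  Covered (column m D) (column (suc m) D) (column (suc (suc m)) D)
column-covered {n} {D} dom m m<n i with dom (i , fromℕ< m<n)
... | (i′ , h) , x∈D , near = x∈p∪q⁺ (Sum.map₁ x∈p∪q⁺ (side near))
  where
  here≡ : toℕ (fromℕ< m<n) ≡ m
  here≡ = Fin.toℕ-fromℕ< m<n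

  side : InN (Grid n) (i , fromℕ< m<n) (i′ , h) →
    (i ∈ˢ column m D ⊎ i ∈ˢ close (column (suc m) D)) ⊎ i ∈ˢ column (suc (suc m)) D
  side (inj₁ refl) = inj₁ (inj₂ (∈-close _ i (∈-column (suc m) (cong suc here≡) x∈D)))
  side (inj₂ (inj₁ (refl , inj₁ right))) =
    inj₂ (∈-column _ (cong suc (trans (sym right) (cong suc here≡))) x∈D)
  side (inj₂ (inj₁ (refl , inj₂ left))) = inj₁ (inj₁ (∈-column m (trans left here≡) x∈D))
  side (inj₂ (inj₂ (adj , refl))) =
    inj₁ (inj₂ (adj-∈-close _ i i′ adj (∈-column (suc m) (cong suc here≡) x∈D)))

-- The steps telescope; `suc m` columns involve only `m` steps, hence `3 * m`.
potential-bound : ∀ {n} {D : List (Cell n)} → Dominating (Grid n) D → ∀ m → m < n →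
  potential (column m D) (column (suc m) D) + 3 * m ≤ 4 * columns-size (suc m) D
potential-bound {D = D} dom zero m<n = begin
  potential (column 0 D) c + 0  ≡⟨ ℕ.+-identityʳ _ ⟩
  potential (column 0 D) c      ≡⟨ cong (λ p → potential p c) (column-0 D) ⟩
  potential ⊥ c                 ≤⟨ potential-start c ⟩
  4 * ∣ c ∣                     ∎
  where
  open ℕ.≤-Reasoning
  c = column 1 D
  column-0 : ∀ {n} (D : List (Cell n)) → column 0 D ≡ ⊥
  column-0 []      = refl
  column-0 (_ ∷ D) = column-0 D
potential-bound {D = D} dom (suc m) m<n = begin
  potential c x + 3 * suc m          ≡⟨ solve 2 (λ a b → a :+ con 3 :* (con 1 :+ b) := (a :+ con 3) :+ con 3 :* b) refl (potential c x) m ⟩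
  (potential c x + 3) + 3 * m        ≤⟨ ℕ.+-monoˡ-≤ _ (potential-step p c x (column-covered dom m (ℕ.<⇒≤ m<n))) ⟩
  (potential p c + 4 * ∣ x ∣) + 3 * m ≡⟨ solve 3 (λ a b d → (a :+ b) :+ d := (a :+ d) :+ b) refl (potential p c) (4 * ∣ x ∣) (3 * m) ⟩
  (potential p c + 3 * m) + 4 * ∣ x ∣ ≤⟨ ℕ.+-monoˡ-≤ _ (potential-bound dom m (ℕ.<⇒≤ m<n)) ⟩
  4 * columns-size (suc m) D + 4 * ∣ x ∣ ≡⟨ ℕ.*-distribˡ-+ 4 (columns-size (suc m) D) ∣ x ∣ ⟨
  4 * columns-size (suc (suc m)) D   ∎
  where
  open ℕ.≤-Reasoning
  open +-*-Solver
  p = column m D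
  c = column (suc m) D
  x = column (suc (suc m)) D

dominating-size : ∀ {n} (D : List (Cell (suc n))) → Dominating (Grid (suc n)) D → 3 * suc n < 4 * length D
dominating-size {n} D dom = begin
  suc (3 * suc n)                ≡⟨ solve 1 (λ a → con 1 :+ con 3 :* (con 1 :+ a) := con 4 :+ con 3 :* a) refl n ⟩
  -- The final 4 exceeds by one the 3 that the first column did not contribute, which makes the
  -- inequality strict.
  4 + 3 * n                      ≤⟨ ℕ.+-monoˡ-≤ _ (potential-end p c covered) ⟩
  potential p c + 3 * n          ≤⟨ potential-bound dom n ℕ.≤-refl ⟩
  4 * columns-size (suc n) D     ≤⟨ ℕ.*-monoʳ-≤ 4 (columns-size≤length (suc n) D) ⟩
  4 * length D                   ∎
  where
  open ℕ.≤-Reasoning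
  open +-*-Solver
  p = column n D
  c = column (suc n) D
  covered : Covered p c ⊥
  covered = subst (Covered p c) (column-beyond D) (column-covered dom n ℕ.≤-refl)

-- Deriving the two numerical bounds.

γ-lower : ∀ n k → DomWins (Grid (suc n)) k [] [] → (3 * suc n + 4) / 4 ≤ k
γ-lower n k wins with domWins⇒dominating k [] [] (λ (u , won) → ¬Any[] (won u (inj₁ refl))) wins
  where open FiniteGame (Grid (suc n)) _≟_ any-cell? inN?
-- The floor is at most `k` because `3 * suc n + 4` is below `4 * suc k`.
... | D , dom , len = s≤s⁻¹ (m<n*o⇒m/o<n (begin-strict
  3 * suc n + 4     <⟨ ℕ.+-monoˡ-< 4 (ℕ.<-≤-trans (dominating-size D dom) (ℕ.*-monoʳ-≤ 4 len)) ⟩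
  4 * (k + 0) + 4   ≡⟨ solve 1 (λ k → con 4 :* (k :+ con 0) :+ con 4 := (con 1 :+ k) :* con 4) refl k ⟩
  suc k * 4         ∎))
  where
  open ℕ.≤-Reasoning
  open +-*-Solver

data Mod3 : ℕ → Set where
  3m   : ∀ m → Mod3 (m * 3)
  3m+1 : ∀ m → Mod3 (1 + m * 3)
  3m+2 : ∀ m → Mod3 (2 + m * 3)

mod3 : ∀ n → Mod3 n
mod3 zero = 3m 0
mod3 (suc n) with mod3 n
... | 3m m   = 3m+1 m
... | 3m+1 m = 3m+2 m
... | 3m+2 m = 3m (suc m)

σ-3m : ∀ m → σ (m * 3) ≡ + 0
σ-3m m rewrite [m+kn]%n≡m%n 0 m 3 ⦃ _ ⦄ = refl

σ-3m+1 : ∀ m → σ (1 + m * 3) ≡ ℤ.-[1+ 0 ]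
σ-3m+1 m rewrite [m+kn]%n≡m%n 1 m 3 ⦃ _ ⦄ = refl

σ-3m+2 : ∀ m → σ (2 + m * 3) ≡ + 1
σ-3m+2 m rewrite [m+kn]%n≡m%n 2 m 3 ⦃ _ ⦄ = refl

γ-upper : ∀ n → 1 ≤ n → ∃ λ k → DomWins (Grid n) k [] [] × + (3 * k) ≡ + (4 * n) ℤ.+ σ n
γ-upper n 1≤n with mod3 n
... | 3m (suc m) = _ , domWins-3m m , (begin
  + (3 * (suc m * 4))                       ≡⟨ cong ℤ.+_ (solve 1 (λ a → con 3 :* (a :* con 4) := con 4 :* (a :* con 3) :+ con 0) refl (suc m)) ⟩
  + (4 * (suc m * 3)) ℤ.+ + 0               ≡⟨ cong (λ s → + (4 * (suc m * 3)) ℤ.+ s) (σ-3m (suc m)) ⟨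
  + (4 * (suc m * 3)) ℤ.+ σ (suc m * 3)     ∎)
  where
  open ≡-Reasoning
  open +-*-Solver
... | 3m+1 m = _ , domWins-3m+1 m , (begin
  -- The solver's right side is `4 * (1 + m * 3)` with one successor removed, to which adding -1
  -- computes.
  + (3 * (1 + m * 4))                       ≡⟨ cong ℤ.+_ (solve 1 (λ a → con 3 :* (con 1 :+ a :* con 4) := a :* con 3 :+ con 3 :* (con 1 :+ a :* con 3)) refl m) ⟩
  + (4 * (1 + m * 3)) ℤ.+ ℤ.-[1+ 0 ]        ≡⟨ cong (λ s → + (4 * (1 + m * 3)) ℤ.+ s) (σ-3m+1 m) ⟨
  + (4 * (1 + m * 3)) ℤ.+ σ (1 + m * 3)     ∎)
  where
  open ≡-Reasoning
  open +-*-Solver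
... | 3m+2 m = _ , domWins-3m+2 m , (begin
  + (3 * (3 + m * 4))                       ≡⟨ cong ℤ.+_ (solve 1 (λ a → con 3 :* (con 3 :+ a :* con 4) := con 4 :* (con 2 :+ a :* con 3) :+ con 1) refl m) ⟩
  + (4 * (2 + m * 3)) ℤ.+ + 1               ≡⟨ cong (λ s → + (4 * (2 + m * 3)) ℤ.+ s) (σ-3m+2 m) ⟨
  + (4 * (2 + m * 3)) ℤ.+ σ (2 + m * 3)     ∎)
  where
  open ≡-Reasoning
  open +-*-Solver

theorem3p5 : ∀ (n : ℕ) → 2 ≤ n →
    ∃ λ (γ : ℕ) → IsGammaMB (Path 3 □ Path n) γ ×
    ((3 * n + 4) / 4 ≤ γ × (+ (3 * γ)) ℤ.≤ (+ (4 * n)) ℤ.+ σ n)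
theorem3p5 n@(suc n′) _ with γ-upper n (s≤s z≤n)
-- `γ-upper` gives only some winning `k`; the least winning count is the exact value and is at most
-- `k`.
... | k , wins , 3k≡ with least (λ j → FiniteGame.domWins? (Grid n) _≟_ any-cell? inN? j [] []) k wins
...   | γ , γ-wins , γ-least = γ , (γ-wins , γ-least) , γ-lower n′ γ γ-wins ,
  ℤₚ.≤-trans (ℤ.+≤+ (ℕ.*-monoʳ-≤ 3 (γ-least k wins))) (ℤₚ.≤-reflexive 3k≡)
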